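{- The maximum size of a set system $\mathcal{F}\subseteq\binom{[6]}{3}$ with VC-dimension at most $2$ is exactly $13$; that is, every $\mathcal{F}\subseteq\binom{[6]}{3}$ with VC-dimension at most $2$ satisfies $|\mathcal{F}|\le 13$, and there exists such an $\mathcal{F}$ with $|\mathcal{F}|=13$.
   Context: Here $[6]=\{1,\dots,6\}$ and $\binom{[6]}{3}$ denotes the collection of all $3$-element subsets of $[6]$. A set system $\mathcal{F}\subseteq 2^{X}$ shatters $S\subseteq X$ if $\{F\cap S: F\in\mathcal{F}\}=2^{S}$. The VC-dimension of $\mathcal{F}$ is the largest integer $d$ such that some $S\subseteq X$ with $|S|=d$ is shattered by $\mathcal{F}$; "VC-dimension at most $2$" means that no $3$-element subset of $[6]$ is shattered by $\mathcal{F}$. -}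

module Defs where

open import Data.Fin.Subset using (Subset; _⊆_; _∩_; ∣_∣)
open import Data.List using (List; length; map)
open import Data.List.Membership.Propositional using (_∈_)
open import Data.List.Relation.Unary.All using (All)
open import Data.List.Relation.Unary.Unique.Propositional using (Unique)
open import Data.Nat using (ℕ; suc)
open import Function.Bundles using (_⇔_)
open import Relation.Binary.PropositionalEquality using (_≡_)
open import Relation.Nullary using (¬_)

-- A set system on Fin n, presented as a duplicate-free list of its members, so
-- that its cardinality is the length of the list.  No definition below depends
-- on the order of the list.
record SetSystem (n : ℕ) : Set where
  field
    members : List (Subset n)
    unique  : Unique members

open SetSystem public

size : ∀ {n} → SetSystem n → ℕ
size 𝓕 = length (members 𝓕)

-- 𝓕 is contained in the collection of all k-element subsets of Fin n.
Uniform : ∀ {n} → ℕ → SetSystem n → Set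
Uniform k 𝓕 = All (λ F → ∣ F ∣ ≡ k) (members 𝓕)

-- { F ∩ S : F ∈ 𝓕 } = 2^S, as an equality of collections of sets.
Shatters : ∀ {n} → SetSystem n → Subset n → Set
Shatters 𝓕 S = ∀ T → T ∈ map (_∩ S) (members 𝓕) ⇔ T ⊆ S

-- Subsets of a shattered set are shattered, so bounding the size of every
-- shattered set by d amounts to excluding size d + 1.
VCDim≤ : ∀ {n} → ℕ → SetSystem n → Set
VCDim≤ d 𝓕 = ∀ S → ∣ S ∣ ≡ suc d → ¬ Shatters 𝓕 S

{-# OPTIONS --safe #-}
-- If 𝓕 does not shatter S, then some T ⊆ S is not the trace on S of any member
-- of 𝓕, so 𝓕 remains contained in the candidates whose trace on S is not T.
-- Starting from all twenty triples and branching over T for a set S shattered by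
-- the remaining candidates, each step strictly shrinks the list of candidates,
-- and every branch reaches a list of at most thirteen.
module Submission where

open import Defs
open import Data.Bool using (Bool; false; T; _∧_; _∨_)
open import Data.Bool.ListAction using (all; any)
import Data.Bool.Properties as Bool
open import Data.Fin using (zero; suc)
open import Data.Fin.Properties using (injective⇒≤)
open import Data.Fin.Subset using (Subset; inside; outside; ⊤; _⊆_; _∩_; ∣_∣)
open import Data.Fin.Subset.Properties
  using (drop-∷-⊆; out⊆; s⊆s; ⊆⊤; p∩q⊆q)
open import Data.List using (List; []; _∷_; _++_; length; lookup; map; filter)
open import Data.List.Membership.DecPropositional using (_∈?_)
open import Data.List.Membership.Propositional using (_∈_; find)
open import Data.List.Membership.Propositional.Properties
  using (∈-map⁺; ∈-map⁻; ∈-++⁺ˡ; ∈-++⁺ʳ; ∈-++⁻; ∈-filter⁺; ∈-filter⁻; ∈-lookup)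
open import Data.List.Membership.Setoid.Properties using (index-injective)
open import Data.List.Relation.Binary.Subset.Propositional using () renaming (_⊆_ to _⊆ˡ_)
open import Data.List.Relation.Unary.All as All using (All; all?; tabulate)
open import Data.List.Relation.Unary.All.Properties using (all⁺)
open import Data.List.Relation.Unary.AllPairs using (_∷_)
open import Data.List.Relation.Unary.Any using (here; index)
open import Data.List.Relation.Unary.Any.Properties using (any⁻)
import Data.List.Relation.Unary.Unique.DecPropositional as UniqueDec
open import Data.List.Relation.Unary.Unique.Propositional using (Unique)
open import Data.List.Relation.Unary.Unique.Propositional.Properties
  using (Unique[x∷xs]⇒x∉xs)
open import Data.Nat using (ℕ; zero; suc; _≤_; _≤ᵇ_; _≤?_)
import Data.Nat.Properties as ℕ
open import Data.Product using (_×_; ∃-syntax; _,_; proj₁; proj₂)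
open import Data.Sum using (inj₁; inj₂)
open import Data.Unit using (tt)
open import Data.Vec using ([]; _∷_; here)
open import Data.Vec.Properties using (≡-dec)
open import Function using (_∘_; mk⇔; Equivalence)
open import Relation.Binary.Definitions using (DecidableEquality)
open import Relation.Binary.PropositionalEquality
  using (_≡_; refl; sym; cong; subst; setoid)
open import Relation.Nullary using (Dec; ¬_; ¬?; does; contradiction)
open import Relation.Nullary.Decidable using (from-yes; decidable-stable)

lookup-injective : ∀ {A : Set} {xs : List A} → Unique xs →
                   ∀ {i j} → lookup xs i ≡ lookup xs j → i ≡ j
lookup-injective {xs = _ ∷ _} _       {zero}  {zero}  _  = refl
lookup-injective {xs = _ ∷ _} u       {zero}  {suc j} eq =
  contradiction (subst (_∈ _) (sym eq) (∈-lookup j)) (Unique[x∷xs]⇒x∉xs u)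
lookup-injective {xs = _ ∷ _} u       {suc i} {zero}  eq =
  contradiction (subst (_∈ _) eq (∈-lookup i)) (Unique[x∷xs]⇒x∉xs u)
lookup-injective {xs = _ ∷ _} (_ ∷ u) {suc i} {suc j} eq = cong suc (lookup-injective u eq)

-- Sending each position of `xs` to the position in `ys` where its entry is found is injective:
-- equal positions give equal entries, and `xs` has no repeats.
Unique∧⊆⇒length≤ : ∀ {A : Set} {xs ys : List A} → Unique xs → xs ⊆ˡ ys →
                   length xs ≤ length ys
Unique∧⊆⇒length≤ {A} {xs} u xs⊆ys = injective⇒≤ {f = index ∘ xs⊆ys ∘ ∈-lookup}
  (lookup-injective u ∘ index-injective (setoid A) (xs⊆ys (∈-lookup _)) (xs⊆ys (∈-lookup _)))

private
  variable
    n : ℕ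

infix 4 _≟_

_≟_ : DecidableEquality (Subset n)
_≟_ = ≡-dec Bool._≟_

powerset : Subset n → List (Subset n)
powerset []            = [] ∷ []
powerset (outside ∷ S) = map (outside ∷_) (powerset S)
powerset (inside  ∷ S) = map (outside ∷_) (powerset S) ++ map (inside ∷_) (powerset S)

∈-powerset⁺ : {S U : Subset n} → U ⊆ S → U ∈ powerset S
∈-powerset⁺ {S = []}          {[]}          _   = here refl
∈-powerset⁺ {S = outside ∷ S} {outside ∷ U} U⊆S = ∈-map⁺ _ (∈-powerset⁺ (drop-∷-⊆ U⊆S))
∈-powerset⁺ {S = outside ∷ S} {inside  ∷ U} U⊆S with () ← U⊆S here
∈-powerset⁺ {S = inside  ∷ S} {outside ∷ U} U⊆S =
  ∈-++⁺ˡ (∈-map⁺ _ (∈-powerset⁺ (drop-∷-⊆ U⊆S)))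
∈-powerset⁺ {S = inside  ∷ S} {inside  ∷ U} U⊆S =
  ∈-++⁺ʳ _ (∈-map⁺ _ (∈-powerset⁺ (drop-∷-⊆ U⊆S)))

∈-powerset⁻ : {S U : Subset n} → U ∈ powerset S → U ⊆ S
∈-powerset⁻ {S = []} (here refl) ()
∈-powerset⁻ {S = outside ∷ S} U∈ with _ , V∈ , refl ← ∈-map⁻ _ U∈ =
  out⊆ (∈-powerset⁻ V∈)
∈-powerset⁻ {S = inside ∷ S} U∈ with ∈-++⁻ (map (outside ∷_) (powerset S)) U∈
... | inj₁ U∈ˡ with _ , V∈ , refl ← ∈-map⁻ _ U∈ˡ = out⊆ (∈-powerset⁻ V∈)
... | inj₂ U∈ʳ with _ , V∈ , refl ← ∈-map⁻ _ U∈ʳ = s⊆s (∈-powerset⁻ V∈)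

layer : ℕ → List (Subset n)
layer k = filter (λ S → ∣ S ∣ ℕ.≟ k) (powerset ⊤)

∈-layer⁺ : ∀ {k} {S : Subset n} → ∣ S ∣ ≡ k → S ∈ layer k
∈-layer⁺ = ∈-filter⁺ (λ S → ∣ S ∣ ℕ.≟ _) (∈-powerset⁺ ⊆⊤)

∈-layer⁻ : ∀ {k} {S : Subset n} → S ∈ layer k → ∣ S ∣ ≡ k
∈-layer⁻ = proj₂ ∘ ∈-filter⁻ (λ S → ∣ S ∣ ℕ.≟ _) {xs = powerset ⊤}

-- As a function of its own, so that evaluation shares the second list among the
-- membership tests.
_⊆ˡ?_ : ∀ (Us Vs : List (Subset n)) → Dec (All (_∈ Vs) Us)
Us ⊆ˡ? Vs = all? (λ U → _∈?_ _≟_ U Vs) Us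

-- The decidable half of shattering: the converse inclusion is automatic, as every trace on `S` lies
-- in `S`.
AllTraces : List (Subset n) → Subset n → Set
AllTraces R S = All (_∈ map (_∩ S) R) (powerset S)

allTraces? : ∀ (R : List (Subset n)) S → Dec (AllTraces R S)
allTraces? R S = powerset S ⊆ˡ? map (_∩ S) R

AllTraces⇒Shatters : ∀ (𝓕 : SetSystem n) {S} → AllTraces (members 𝓕) S → Shatters 𝓕 S
AllTraces⇒Shatters 𝓕 {S} traces U = mk⇔ below (All.lookup traces ∘ ∈-powerset⁺)
  where
  below : U ∈ map (_∩ S) (members 𝓕) → U ⊆ S
  below U∈ with F , _ , refl ← ∈-map⁻ (_∩ S) U∈ = p∩q⊆q F S

Shatters⇒AllTraces : ∀ (𝓕 : SetSystem n) {S} → Shatters 𝓕 S → AllTraces (members 𝓕) S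
Shatters⇒AllTraces 𝓕 shatters =
  tabulate (λ {U} U∈ → Equivalence.from (shatters U) (∈-powerset⁻ U∈))

avoid : List (Subset n) → Subset n → Subset n → List (Subset n)
avoid R S U = filter (λ F → ¬? (F ∩ S ≟ U)) R

module _ (d m : ℕ) where

  mutual

    -- The fuel `k` bounds the branching depth. The Boolean value lets a closed instance be settled
    -- by evaluation alone.
    certify : ℕ → List (Subset n) → Bool
    certify k R = (length R ≤ᵇ m) ∨ branch k R

    branch : ℕ → List (Subset n) → Bool
    branch zero    R = false
    branch (suc k) R = any (split k R) (layer (suc d))

    -- The first conjunct plays no role in soundness: it ensures that every
    -- branch discards a candidate.
    split : ℕ → List (Subset n) → Subset n → Bool
    split k R S = does (allTraces? R S) ∧ all (λ U → certify k (avoid R S U)) (powerset S)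

  -- Induction on the fuel. Were `𝓕` larger than `m`, no certified branch could contain it, so every
  -- subset of the chosen `S` would be a trace and `S` would be shattered.
  certify-sound : ∀ k {R} → T (certify {n} k R) → (𝓕 : SetSystem n) → VCDim≤ d 𝓕 →
                  members 𝓕 ⊆ˡ R → size 𝓕 ≤ m
  certify-sound k {R} cert 𝓕 vc 𝓕⊆R with Equivalence.to Bool.T-∨ cert
  ... | inj₁ small = ℕ.≤-trans (Unique∧⊆⇒length≤ (unique 𝓕) 𝓕⊆R) (ℕ.≤ᵇ⇒≤ _ _ small)
  certify-sound (suc k) {R} cert 𝓕 vc 𝓕⊆R | inj₂ some
    with S , S∈ , splits ← find (any⁻ (split k R) (layer (suc d)) some)
    = decidable-stable (size 𝓕 ≤? m) λ large →
        vc S (∈-layer⁻ S∈) (AllTraces⇒Shatters 𝓕 (All.map (trace large) certs))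
    where
    certs : All (λ U → T (certify k (avoid R S U))) (powerset S)
    certs = all⁺ _ _ (proj₂ (Equivalence.to Bool.T-∧ splits))

    trace : ¬ size 𝓕 ≤ m → ∀ {U} → T (certify k (avoid R S U)) →
            U ∈ map (_∩ S) (members 𝓕)
    trace large {U} cert′ = decidable-stable (_∈?_ _≟_ U _) λ U∉ →
      large (certify-sound k cert′ 𝓕 vc λ F∈ →
        ∈-filter⁺ (λ F → ¬? (F ∩ S ≟ U)) (𝓕⊆R F∈)
          -- A member meeting `S` in `U` would make `U` a trace, so every member survives the
          -- filter.
          λ { refl → U∉ (∈-map⁺ (_∩ S) F∈) })

triples : List (Subset 6)
triples = layer 3

-- {0,1,2}, {0,1,3}, {0,1,4}, {0,2,3}, {0,2,5}, {1,2,4}, {1,2,5}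
omitted : List (Subset 6)
omitted =
  (inside  ∷ inside  ∷ inside  ∷ outside ∷ outside ∷ outside ∷ []) ∷
  (inside  ∷ inside  ∷ outside ∷ inside  ∷ outside ∷ outside ∷ []) ∷
  (inside  ∷ inside  ∷ outside ∷ outside ∷ inside  ∷ outside ∷ []) ∷
  (inside  ∷ outside ∷ inside  ∷ inside  ∷ outside ∷ outside ∷ []) ∷
  (inside  ∷ outside ∷ inside  ∷ outside ∷ outside ∷ inside  ∷ []) ∷
  (outside ∷ inside  ∷ inside  ∷ outside ∷ inside  ∷ outside ∷ []) ∷
  (outside ∷ inside  ∷ inside  ∷ outside ∷ outside ∷ inside  ∷ []) ∷ []

extremal : SetSystem 6
extremal = record
  { members = family
  ; unique  = from-yes (UniqueDec.unique? _≟_ family)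
  }
  where
  family : List (Subset 6)
  family = filter (λ F → ¬? (_∈?_ _≟_ F omitted)) triples

extremal-uniform : Uniform 3 extremal
extremal-uniform = from-yes (all? (λ F → ∣ F ∣ ℕ.≟ 3) (members extremal))

-- No two omitted triples are complementary, so fourteen triples lose the full or the empty trace.
-- The other six lose a smaller one: {0,1} on {0,1,5}, {2} on {2,3,4}, {0,2} on {0,2,4}, {1} on
-- {1,3,5}, {0} on {0,4,5} and {1,2} on {1,2,3}.
extremal-VCDim≤2 : VCDim≤ 2 extremal
extremal-VCDim≤2 S ∣S∣≡3 = All.lookup unshattered (∈-layer⁺ ∣S∣≡3) ∘ Shatters⇒AllTraces extremal
  where
  unshattered : All (λ S → ¬ AllTraces (members extremal) S) triples
  unshattered = from-yes (all? (λ S → ¬? (allTraces? (members extremal) S)) triples)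

mainTheorem2 : ((𝓕 : SetSystem 6) → Uniform 3 𝓕 → VCDim≤ 2 𝓕 → size 𝓕 ≤ 13)
    × (∃[ 𝓕 ] (Uniform {6} 3 𝓕 × VCDim≤ 2 𝓕 × size 𝓕 ≡ 13))
mainTheorem2 =
  -- Fuel 7 = 20 - 13 is enough, as each level discards at least one of the twenty triples. Checking
  -- `tt` runs the whole search.
  (λ 𝓕 uniform vc → certify-sound 2 13 7 {triples} tt 𝓕 vc (∈-layer⁺ ∘ All.lookup uniform)) ,
  (extremal , extremal-uniform , extremal-VCDim≤2 , refl)
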